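{- Let $G=(V,E)$ be a function graph with layers $(V_1,V_2,\dots,V_k)$, and let $H^\circ=(V^\circ,E^\circ)$ be its contraction graph, with $V^\circ=\{v_1,\dots,v_k\}$ and, for $i\neq j$, $v_iv_j\in E^\circ$ if and only if there exist $u_i\in V_i$ and $u_j\in V_j$ with $u_iu_j\in E$. Then $H^\circ$ is an interval graph.
   Context: A finite simple graph $G=(V,E)$ is a function graph if each vertex $v\in V$ can be assigned a continuous function $t\mapsto v(t)\in\mathbb{R}$ on a common interval $I$ ($I=[0,1]$ or $I=\mathbb{R}$) such that, for distinct $u,v\in V$, $uv\in E$ if and only if $u(t)=v(t)$ for some $t\in I$. Such a family of functions is fixed. Write $u>v$ (equivalently $v<u$) if $u(t)>v(t)$ for all $t\in I$. For $S\subseteq V$, $S_{\max}:=\{u\in S : \text{there is no } w\in S \text{ with } w>u\}$. The layers of $V$ are defined by $V_1:=V_{\max}$ and $V_i:=\bigl(V\setminus\bigcup_{j=1}^{i-1}V_j\bigr)_{\max}$, continuing until $V$ is exhausted; $(V_1,\dots,V_k)$ is the resulting partition of $V$ into nonempty layers. An interval graph is a graph admitting a representation in which each vertex corresponds to an interval on the real line and two distinct vertices are adjacent if and only if their intervals intersect. -}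

module Defs where

open import Level using (Level; 0ℓ) renaming (suc to lsuc)
open import Data.Nat using (ℕ; zero; suc)
open import Data.Fin using (Fin; toℕ)
open import Data.Product using (∃; ∃-syntax; Σ; _×_; _,_)
open import Data.Rational using (ℚ; 0ℚ; 1ℚ; _+_; _-_; -_) renaming (_<_ to _<ℚ_)
import Data.Rational.Properties as ℚ
open import Data.Sum using (_⊎_; inj₁; inj₂)
open import Data.Unit.Polymorphic using (⊤)
open import Function.Bundles using (_⇔_; mk⇔)
open import Relation.Binary using (Rel; Symmetric; Irreflexive; tri<; tri≈; tri>)
open import Relation.Binary.PropositionalEquality using (_≡_; _≢_; sym; subst)
open import Relation.Nullary using (¬_)
open import Relation.Unary using (Pred; _∈_; _∖_; _≬_; U; Satisfiable; Empty)

1ℓ : Level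
1ℓ = lsuc 0ℓ

-- Dedekind reals: q ∈ L means q < x, and q ∈ R means x < q.
record ℝ : Set₁ where
  field
    L R         : Pred ℚ 0ℓ
    L-inhabited : Satisfiable L
    R-inhabited : Satisfiable R
    L-rounded   : ∀ q → q ∈ L ⇔ (∃[ r ] (q <ℚ r × r ∈ L))
    R-rounded   : ∀ r → r ∈ R ⇔ (∃[ q ] (q <ℚ r × q ∈ R))
    disjoint    : ∀ q → ¬ (q ∈ L × q ∈ R)
    located     : ∀ {q r} → q <ℚ r → q ∈ L ⊎ r ∈ R

open ℝ public

infix 4 _<ʳ_ _≤ʳ_ _≈ʳ_

_<ʳ_ : Rel ℝ 0ℓ
x <ʳ y = ∃[ q ] (q ∈ R x × q ∈ L y)

_≤ʳ_ : Rel ℝ 0ℓ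
x ≤ʳ y = ∀ q → q ∈ L x → q ∈ L y

-- Equality of reals: distinct records may represent the same cut, so _≡_ is too fine.
_≈ʳ_ : Rel ℝ 0ℓ
x ≈ʳ y = x ≤ʳ y × y ≤ʳ x

fromℚ : ℚ → ℝ
fromℚ p = record
  { L           = _<ℚ p
  ; R           = p <ℚ_
  ; L-inhabited = p - 1ℚ , subst (p - 1ℚ <ℚ_) (ℚ.+-identityʳ p) (ℚ.+-monoʳ-< p (ℚ.negative⁻¹ (- 1ℚ)))
  ; R-inhabited = p + 1ℚ , subst (_<ℚ p + 1ℚ) (ℚ.+-identityʳ p) (ℚ.+-monoʳ-< p (ℚ.positive⁻¹ 1ℚ))
  ; L-rounded   = λ q → mk⇔ (λ q<p → let (m , q<m , m<p) = ℚ.<-dense q<p in m , q<m , m<p)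
                            (λ (r , q<r , r<p) → ℚ.<-trans q<r r<p)
  ; R-rounded   = λ r → mk⇔ (λ p<r → let (m , p<m , m<r) = ℚ.<-dense p<r in m , m<r , p<m)
                            (λ (q , q<r , p<q) → ℚ.<-trans p<q q<r)
  ; disjoint    = λ q (q<p , p<q) → ℚ.<-asym q<p p<q
  ; located     = loc
  }
  where
  loc : ∀ {q r} → q <ℚ r → q <ℚ p ⊎ p <ℚ r
  loc {q} {r} q<r with ℚ.<-cmp q p
  ... | tri< q<p _ _ = inj₁ q<p
  ... | tri≈ _ q≡p _ = inj₂ (subst (_<ℚ r) q≡p q<r)
  ... | tri> _ _ p<q = inj₂ (ℚ.<-trans p<q q<r)

-- The common domain I of the functions: [0,1] or ℝ.
data Domain : Set where
  unitInterval realLine : Domain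

⟦_⟧ : Domain → Pred ℝ 0ℓ
⟦ unitInterval ⟧ t = fromℚ 0ℚ ≤ʳ t × t ≤ʳ fromℚ 1ℚ
⟦ realLine ⟧       = U

Point : Domain → Set₁
Point I = Σ ℝ ⟦ I ⟧

-- Continuity for the order topology on ℝ and the subspace topology on I, in
-- terms of basic open intervals.  In particular a continuous f respects _≈ʳ_.
Continuous : ∀ I → (Point I → ℝ) → Set₁
Continuous I f =
  ∀ ((t , t∈I) : Point I) (a b : ℝ) → a <ʳ f (t , t∈I) → f (t , t∈I) <ʳ b →
  ∃[ c ] ∃[ d ] (c <ʳ t × t <ʳ d ×
    (∀ ((s , s∈I) : Point I) → c <ʳ s → s <ʳ d → a <ʳ f (s , s∈I) × f (s , s∈I) <ʳ b))

-- Adjacency takes values in Set₁ because it may be given by the existence of a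
-- real number.
record SimpleGraph (n : ℕ) : Set₂ where
  field
    Adj        : Rel (Fin n) 1ℓ
    adj-sym    : Symmetric Adj
    adj-irrefl : Irreflexive _≡_ Adj

open SimpleGraph public

record FunctionRepresentation {n : ℕ} (G : SimpleGraph n) : Set₁ where
  field
    I          : Domain
    fun        : Fin n → Point I → ℝ
    continuous : ∀ v → Continuous I (fun v)
    adj⇔meet   : ∀ {u v} → u ≢ v → Adj G u v ⇔ (∃[ t ] (fun u t ≈ʳ fun v t))

record IsInterval (J : Pred ℝ 0ℓ) : Set₁ where
  field
    nonempty : Satisfiable J
    convex   : ∀ {x y z} → x ∈ J → z ∈ J → x ≤ʳ y → y ≤ʳ z → y ∈ J

IsIntervalGraph : ∀ {n} → SimpleGraph n → Set₁
IsIntervalGraph {n} G =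
  Σ (Fin n → Pred ℝ 0ℓ) λ J →
    (∀ v → IsInterval (J v)) ×
    (∀ {u v} → u ≢ v → Adj G u v ⇔ J u ≬ J v)

module _ {n : ℕ} {G : SimpleGraph n} (F : FunctionRepresentation G) where
  open FunctionRepresentation F

  Above : Rel (Fin n) 1ℓ
  Above u v = ∀ t → fun v t <ʳ fun u t

  Max : Pred (Fin n) 1ℓ → Pred (Fin n) 1ℓ
  Max S u = u ∈ S × ¬ (∃[ w ] (w ∈ S × Above w u))

  -- Layers are indexed from 0: layer i is V_{i+1}, and remaining i is
  -- V ∖ (V_1 ∪ … ∪ V_i).
  remaining : ℕ → Pred (Fin n) 1ℓ
  layer     : ℕ → Pred (Fin n) 1ℓ

  remaining zero    = λ _ → ⊤
  remaining (suc i) = remaining i ∖ layer i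

  layer i = Max (remaining i)

  -- (V_1, …, V_k) is the list of all layers: each is nonempty and V is
  -- exhausted after exactly k steps.
  HasLayers : ℕ → Set₁
  HasLayers k = (∀ (i : Fin k) → Satisfiable (layer (toℕ i))) × Empty (remaining k)

  contractionGraph : (k : ℕ) → SimpleGraph k
  contractionGraph k = record
    { Adj        = λ i j → i ≢ j × ∃[ u ] ∃[ v ]
                     (u ∈ layer (toℕ i) × v ∈ layer (toℕ j) × Adj G u v)
    ; adj-sym    = λ (i≢j , u , v , u∈ , v∈ , uv) →
                     (λ j≡i → i≢j (sym j≡i)) , v , u , v∈ , u∈ , adj-sym G uv
    ; adj-irrefl = λ i≡j (i≢j , _) → i≢j i≡j
    }

{-# OPTIONS --safe #-}

-- If i < j < l and some u ∈ V_i meets some v ∈ V_l, take w ∈ V_j above v.  By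
-- maximality of u in its layer w is not above u, and u is not above w since u
-- is not above v; so, by the intermediate value theorem, u meets w.  Hence the
-- neighbours of i after i are consecutive, and [i, r(i)] with r(i) the last of
-- them is an interval representation.
module Submission where

open import Defs
open import Axiom.ExcludedMiddle using (ExcludedMiddle)
open import Data.Empty using (⊥; ⊥-elim)
open import Data.Fin using (Fin; toℕ)
open import Data.Fin.Induction using (spo-wellFounded)
import Data.Fin.Properties as Fin
open import Data.Integer using (+_; +≤+)
import Data.Integer as ℤ
import Data.Integer.Properties as ℤ
open import Data.Nat using (ℕ)
import Data.Nat as ℕ
import Data.Nat.Coprimality as Coprimality
import Data.Nat.Properties as ℕ
open import Data.Product using (∃-syntax; _×_; _,_; proj₁; proj₂; map₂; swap)
open import Data.Rational using (ℚ; mkℚ; 0ℚ; 1ℚ; _⊔_; _⊓_; *≤*) renaming (_<_ to _<ℚ_; _≤_ to _≤ℚ_)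
import Data.Rational.Properties as ℚ
open import Data.Sum using (_⊎_; inj₁; inj₂; [_,_]′)
open import Function.Base using (_∘_)
open import Function.Bundles using (_⇔_; mk⇔; module Equivalence)
open import Induction.WellFounded using (Acc; acc)
open import Level using (Lift; lift; lower; 0ℓ)
open import Relation.Binary using (IsStrictPartialOrder; tri<; tri≈; tri>)
open import Relation.Binary.PropositionalEquality
  using (_≡_; _≢_; refl; sym; subst; subst₂; isEquivalence; resp₂)
open import Relation.Nullary using (¬_; yes; no)
open import Relation.Nullary.Decidable using (True; toWitness; fromWitness; map′)
open import Relation.Unary using (Pred; _∈_; _∉_; _∩_; _≬_)

open Equivalence using (to; from)

-- Order on the Dedekind reals

L-down : ∀ x {p q} → p ≤ℚ q → q ∈ L x → p ∈ L x
L-down x p≤q q∈ = let (r , q<r , r∈) = to (L-rounded x _) q∈ in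
  from (L-rounded x _) (r , ℚ.≤-<-trans p≤q q<r , r∈)

R-up : ∀ x {p q} → p ≤ℚ q → p ∈ R x → q ∈ R x
R-up x p≤q p∈ = let (r , r<p , r∈) = to (R-rounded x _) p∈ in
  from (R-rounded x _) (r , ℚ.<-≤-trans r<p p≤q , r∈)

L<R : ∀ x {p q} → p ∈ L x → q ∈ R x → p <ℚ q
L<R x p∈ q∈ = ℚ.≰⇒> λ q≤p → disjoint x _ (p∈ , R-up x q≤p q∈)

≤ʳ-refl : ∀ x → x ≤ʳ x
≤ʳ-refl x _ q∈ = q∈

≤ʳ-trans : ∀ {x y z} → x ≤ʳ y → y ≤ʳ z → x ≤ʳ z
≤ʳ-trans x≤y y≤z q = y≤z q ∘ x≤y q

<ʳ-≤ʳ-trans : ∀ {x y z} → x <ʳ y → y ≤ʳ z → x <ʳ z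
<ʳ-≤ʳ-trans (q , q∈R , q∈L) y≤z = q , q∈R , y≤z q q∈L

-- Roundedness moves `q` up to `r` inside `L y`; locating `x` in the gap either gives the goal or
-- makes `r` separate `x` from `y`.
≮ʳ⇒≥ʳ : ∀ x y → ¬ x <ʳ y → y ≤ʳ x
≮ʳ⇒≥ʳ x y x≮y q q∈ with to (L-rounded y q) q∈
... | r , q<r , r∈ with located x q<r
... | inj₁ q∈x = q∈x
... | inj₂ r∈x = ⊥-elim (x≮y (r , r∈x , r∈))

<ʳ⇒≤ʳ : ∀ x y → x <ʳ y → x ≤ʳ y
<ʳ⇒≤ʳ x y (q , q∈R , q∈L) p p∈ = L-down y (ℚ.<⇒≤ (L<R x p∈ q∈R)) q∈L

<ʳ⇒≱ʳ : ∀ x y → x <ʳ y → ¬ y ≤ʳ x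
<ʳ⇒≱ʳ x y (q , q∈R , q∈L) y≤x = disjoint x q (y≤x q q∈L , q∈R)

<ʳ-asym : ∀ x y → x <ʳ y → ¬ y <ʳ x
<ʳ-asym x y x<y y<x = <ʳ⇒≱ʳ x y x<y (<ʳ⇒≤ʳ y x y<x)

<ʳ-trans : ∀ x y z → x <ʳ y → y <ʳ z → x <ʳ z
<ʳ-trans x y z x<y y<z = <ʳ-≤ʳ-trans {x} {y} {z} x<y (<ʳ⇒≤ʳ y z y<z)

L⇒<ʳ : ∀ x {q} → q ∈ L x → fromℚ q <ʳ x
L⇒<ʳ x q∈ = to (L-rounded x _) q∈

R⇒>ʳ : ∀ x {q} → q ∈ R x → x <ʳ fromℚ q
R⇒>ʳ x q∈ = let (r , r<q , r∈) = to (R-rounded x _) q∈ in r , r∈ , r<q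

≤-<⇒R : ∀ x {q r} → x ≤ʳ fromℚ q → q <ℚ r → r ∈ R x
≤-<⇒R x {q} x≤q q<r = let (m , q<m , m<r) = ℚ.<-dense q<r in
  [ (λ m∈ → ⊥-elim (ℚ.<-asym q<m (x≤q m m∈))) , (λ r∈ → r∈) ]′ (located x m<r)

fromℚ-mono-≤ : ∀ {p q} → p ≤ℚ q → fromℚ p ≤ʳ fromℚ q
fromℚ-mono-≤ p≤q r r<p = ℚ.<-≤-trans r<p p≤q

fromℚ-cancel-≤ : ∀ {p q} → fromℚ p ≤ʳ fromℚ q → p ≤ℚ q
fromℚ-cancel-≤ p≤q = ℚ.≮⇒≥ (λ q<p → ℚ.<-irrefl refl (p≤q _ q<p))

-- Classical order properties and suprema

em₀ : ExcludedMiddle 1ℓ → ExcludedMiddle 0ℓ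
em₀ em {P} = map′ lower lift (em {Lift 1ℓ P})

-- The order relations on ℝ and the interval predicates live in Set, whereas
-- quantification over ℝ lands in Set₁; truth values bridge the gap.
Truth : ExcludedMiddle 1ℓ → Set₁ → Set
Truth em P = True (em {P})

≤ʳ-total : ExcludedMiddle 1ℓ → ∀ x y → x ≤ʳ y ⊎ y <ʳ x
≤ʳ-total em x y with em₀ em {y <ʳ x}
... | yes y<x = inj₂ y<x
... | no  y≮x = inj₁ (≮ʳ⇒≥ʳ y x y≮x)

<ʳ-connex : ExcludedMiddle 1ℓ → ∀ x y → ¬ x ≈ʳ y → x <ʳ y ⊎ y <ʳ x
<ʳ-connex em x y x≉y with ≤ʳ-total em x y | ≤ʳ-total em y x
... | inj₂ y<x | _        = inj₂ y<x
... | inj₁ _   | inj₂ x<y = inj₁ x<y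
... | inj₁ x≤y | inj₁ y≤x = ⊥-elim (x≉y (x≤y , y≤x))

-- The strict inequalities make both cuts rounded, whether or not `P` contains its own supremum.
IsSupremum : Pred ℚ 1ℓ → ℝ → Set₁
IsSupremum P s = (∀ q → q ∈ L s ⇔ (∃[ r ] (q <ℚ r × r ∈ P)))
               × (∀ q → q ∈ R s ⇔ (∃[ r ] (r <ℚ q × r ∉ P)))

supremum : ExcludedMiddle 1ℓ → (P : Pred ℚ 1ℓ) → (∀ {p q} → p ≤ℚ q → q ∈ P → p ∈ P) →
           ∃[ p ] p ∈ P → ∃[ q ] q ∉ P →
           ∃[ s ] IsSupremum P s
supremum em P P-down (p , p∈P) (p′ , p′∉P) = s , L⇔ , R⇔
  where
  below above : Pred ℚ 0ℓ
  below q = ∃[ r ] (q <ℚ r × Truth em (P r))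
  above q = ∃[ r ] (r <ℚ q × ¬ Truth em (P r))

  loc : ∀ {q r} → q <ℚ r → q ∈ below ⊎ r ∈ above
  loc q<r with ℚ.<-dense q<r
  -- Deciding `P` at one rational inside the gap settles locatedness.
  ... | m , q<m , m<r with em₀ em {Truth em (P m)}
  ... | yes Pm = inj₁ (m , q<m , Pm)
  ... | no ¬Pm = inj₂ (m , m<r , ¬Pm)

  s : ℝ
  s = record
    { L           = below
    ; R           = above
    ; L-inhabited = let (q , q<p) = L-inhabited (fromℚ p) in q , p , q<p , fromWitness p∈P
    ; R-inhabited = let (q , p′<q) = R-inhabited (fromℚ p′) in q , p′ , p′<q , p′∉P ∘ toWitness
    ; L-rounded   = λ q → mk⇔
        (λ (r , q<r , Pr) → let (m , q<m , m<r) = ℚ.<-dense q<r in m , q<m , r , m<r , Pr)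
        (λ (m , q<m , r , m<r , Pr) → r , ℚ.<-trans q<m m<r , Pr)
    ; R-rounded   = λ q → mk⇔
        (λ (r , r<q , ¬Pr) → let (m , r<m , m<q) = ℚ.<-dense r<q in m , m<q , r , r<m , ¬Pr)
        (λ (m , m<q , r , r<m , ¬Pr) → r , ℚ.<-trans r<m m<q , ¬Pr)
    ; disjoint    = λ q ((r , q<r , Pr) , (r′ , r′<q , ¬Pr′)) →
        ¬Pr′ (fromWitness (P-down (ℚ.<⇒≤ (ℚ.<-trans r′<q q<r)) (toWitness Pr)))
    ; located     = loc
    }

  L⇔ : ∀ q → q ∈ L s ⇔ (∃[ r ] (q <ℚ r × r ∈ P))
  L⇔ q = mk⇔ (λ (r , q<r , Pr) → r , q<r , toWitness Pr)
             (λ (r , q<r , Pr) → r , q<r , fromWitness Pr)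

  R⇔ : ∀ q → q ∈ R s ⇔ (∃[ r ] (r <ℚ q × r ∉ P))
  R⇔ q = mk⇔ (λ (r , r<q , ¬Pr) → r , r<q , ¬Pr ∘ fromWitness)
             (λ (r , r<q , ¬Pr) → r , r<q , ¬Pr ∘ toWitness)

-- Continuous functions that never meet

domain-convex : ∀ I x y z → x ∈ ⟦ I ⟧ → z ∈ ⟦ I ⟧ → x ≤ʳ y → y ≤ʳ z → y ∈ ⟦ I ⟧
domain-convex unitInterval x y z (0≤x , _) (_ , z≤1) x≤y y≤z =
  ≤ʳ-trans {fromℚ 0ℚ} {x} {y} 0≤x x≤y , ≤ʳ-trans {y} {z} {fromℚ 1ℚ} y≤z z≤1
domain-convex realLine _ _ _ _ _ _ _ = _

domain-point : ∀ I → Point I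
domain-point unitInterval = fromℚ 0ℚ , ≤ʳ-refl (fromℚ 0ℚ) , fromℚ-mono-≤ {0ℚ} {1ℚ} (ℚ.nonNegative⁻¹ 1ℚ)
domain-point realLine     = fromℚ 0ℚ , _

module _ (I : Domain) where

  -- Neighbourhoods with rational endpoints: they intersect by `⊔` and `⊓`, and membership is tested
  -- directly on cuts.
  Near : Point I → Pred (Point I) 0ℓ → Set₁
  Near (t , _) P = ∃[ c ] ∃[ d ] (c ∈ L t × d ∈ R t ×
    (∀ (s : Point I) → c ∈ L (proj₁ s) → d ∈ R (proj₁ s) → s ∈ P))

  continuous⇒Near : ∀ f → Continuous I f → ∀ t a b → a <ʳ f t → f t <ʳ b →
                    Near t (λ s → a <ʳ f s × f s <ʳ b)
  continuous⇒Near f cf t a b a<ft ft<b with cf t a b a<ft ft<b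
  ... | c , d , (p , p∈Rc , p∈Lt) , (q , q∈Rt , q∈Ld) , near =
    p , q , p∈Lt , q∈Rt , λ s p∈Ls q∈Rs → near s (p , p∈Rc , p∈Ls) (q , q∈Rs , q∈Ld)

  Near-∩ : ∀ (t : Point I) (P Q : Pred (Point I) 0ℓ) → Near t P → Near t Q → Near t (P ∩ Q)
  Near-∩ (t , _) P Q (c , d , c∈ , d∈ , P-near) (c′ , d′ , c′∈ , d′∈ , Q-near) =
    c ⊔ c′ , d ⊓ d′ , ⊔∈L , ⊓∈R , λ s c⊔c′∈ d⊓d′∈ →
      P-near s (L-down (proj₁ s) (ℚ.p≤p⊔q c c′) c⊔c′∈) (R-up (proj₁ s) (ℚ.p⊓q≤p d d′) d⊓d′∈) ,
      Q-near s (L-down (proj₁ s) (ℚ.p≤q⊔p c c′) c⊔c′∈) (R-up (proj₁ s) (ℚ.p⊓q≤q d d′) d⊓d′∈)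
    where
    ⊔∈L : c ⊔ c′ ∈ L t
    ⊔∈L with ℚ.⊔-sel c c′
    ... | inj₁ eq = subst (_∈ L t) (sym eq) c∈
    ... | inj₂ eq = subst (_∈ L t) (sym eq) c′∈
    ⊓∈R : d ⊓ d′ ∈ R t
    ⊓∈R with ℚ.⊓-sel d d′
    ... | inj₁ eq = subst (_∈ R t) (sym eq) d∈
    ... | inj₂ eq = subst (_∈ R t) (sym eq) d′∈

  -- The rational `q` witnessing `f t <ʳ g t` separates the two functions: near `t`, `f` stays below
  -- it and `g` above it.
  <ʳ-Near : ∀ f g → Continuous I f → Continuous I g →
            ∀ t → f t <ʳ g t → Near t (λ s → f s <ʳ g s)
  <ʳ-Near f g cf cg t (q , q∈R , q∈L) =
    let (a , a∈) = L-inhabited (f t)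
        (b , b∈) = R-inhabited (g t)
        (c , d , c∈ , d∈ , near) = Near-∩ t
          (λ s → fromℚ a <ʳ f s × f s <ʳ fromℚ q) (λ s → fromℚ q <ʳ g s × g s <ʳ fromℚ b)
          (continuous⇒Near f cf t (fromℚ a) (fromℚ q) (L⇒<ʳ (f t) a∈) (R⇒>ʳ (f t) q∈R))
          (continuous⇒Near g cg t (fromℚ q) (fromℚ b) (L⇒<ʳ (g t) q∈L) (R⇒>ʳ (g t) b∈))
    in c , d , c∈ , d∈ , λ s c∈s d∈s →
      let ((_ , fs<q) , (q<gs , _)) = near s c∈s d∈s
      in <ʳ-trans (f s) (fromℚ q) (g s) fs<q q<gs

  module _ (f g : Point I → ℝ) (a : Point I) where

    -- For `r` before `a` the condition is vacuous, so this set is inhabited and down-closed in all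
    -- of `ℚ`, as `supremum` requires.
    LessFromUpTo : Pred ℚ 1ℓ
    LessFromUpTo r = ∀ (t : Point I) → proj₁ a ≤ʳ proj₁ t → proj₁ t ≤ʳ fromℚ r → f t <ʳ g t

    LessFromUpTo-down : ∀ {p q} → p ≤ℚ q → q ∈ LessFromUpTo → p ∈ LessFromUpTo
    LessFromUpTo-down {p} {q} p≤q f<g t a≤t t≤p =
      f<g t a≤t (≤ʳ-trans {proj₁ t} {fromℚ p} {fromℚ q} t≤p (fromℚ-mono-≤ p≤q))

    L⊆LessFromUpTo : ∀ {r} → r ∈ L (proj₁ a) → r ∈ LessFromUpTo
    L⊆LessFromUpTo r∈ t a≤t t≤r = ⊥-elim (ℚ.<-irrefl refl (t≤r _ (a≤t _ r∈)))

    ¬LessFromUpTo : ∀ (b : Point I) {r} → proj₁ a ≤ʳ proj₁ b → g b <ʳ f b →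
                    r ∈ R (proj₁ b) → r ∉ LessFromUpTo
    ¬LessFromUpTo b a≤b gb<fb r∈ f<g =
      <ʳ-asym (f b) (g b) (f<g b a≤b (λ _ p∈ → L<R (proj₁ b) p∈ r∈)) gb<fb

  -- With σ the supremum of the r such that f < g on [a, r], either sign of
  -- f σ - g σ persists near σ and contradicts the choice of σ.
  no-crossing : ExcludedMiddle 1ℓ → ∀ f g → Continuous I f → Continuous I g →
                (∀ t → ¬ f t ≈ʳ g t) →
                ∀ (a b : Point I) → proj₁ a ≤ʳ proj₁ b → f a <ʳ g a → ¬ g b <ʳ f b
  no-crossing em f g cf cg f≉g â@(a , a∈I) b̂@(b , b∈I) a≤b fa<ga gb<fb =
    contra (supremum em P (LessFromUpTo-down f g â)
      (map₂ (L⊆LessFromUpTo f g â) (L-inhabited a))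
      (map₂ R[b]∉P (R-inhabited b)))
    where
    P : Pred ℚ 1ℓ
    P = LessFromUpTo f g â

    R[b]∉P : ∀ {r} → r ∈ R b → r ∉ P
    R[b]∉P = ¬LessFromUpTo f g â b̂ a≤b gb<fb

    contra : ∃[ σ ] IsSupremum P σ → ⊥
    contra (σ , L⇔ , R⇔) = [ f≮g , g≮f ]′ (<ʳ-connex em (f s) (g s) (f≉g s))
      where
      a≤σ : a ≤ʳ σ
      a≤σ q q∈ = let (r , q<r , r∈) = to (L-rounded a q) q∈ in
        from (L⇔ q) (r , q<r , L⊆LessFromUpTo f g â r∈)

      σ≤b : σ ≤ʳ b
      σ≤b q q∈ = let (r , q<r , Pr) = to (L⇔ q) q∈ in
        [ (λ q∈b → q∈b) , (λ r∈b → ⊥-elim (R[b]∉P r∈b Pr)) ]′ (located b q<r)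

      s : Point I
      s = σ , domain-convex I a σ b a∈I b∈I a≤σ σ≤b

      f≮g : ¬ f s <ʳ g s
      f≮g fs<gs =
        -- Some `r` below `d` lies outside `P`. Yet a point of `[a, r]` is either beyond `c`, where
        -- `near` applies, or before `c′`, where `Pr′` applies; the gap between `c` and `c′` lets
        -- `located` decide.
        let (c , d , c∈ , d∈ , near) = <ʳ-Near f g cf cg s fs<gs
            (r , r<d , ¬Pr)    = to (R⇔ d) d∈
            (c′ , c<c′ , c′∈)  = to (L-rounded σ c) c∈
            (r′ , c′<r′ , Pr′) = to (L⇔ c′) c′∈
        in ¬Pr λ t a≤t t≤r →
          [ (λ c∈t → near t c∈t (≤-<⇒R (proj₁ t) t≤r r<d))
          , (λ c′∈t → Pr′ t a≤t (λ _ p∈ → ℚ.<-trans (L<R (proj₁ t) p∈ c′∈t) c′<r′))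
          ]′ (located (proj₁ t) c<c′)

      g≮f : ¬ g s <ʳ f s
      g≮f gs<fs =
        -- The rational `q`, between `c` and `σ`, serves as a point where `Pr` and `near` disagree.
        -- It is not before `a`: otherwise `c` would be too, and `near` at `a` would contradict
        -- `fa<ga`.
        let (c , d , c∈ , d∈ , near) = <ʳ-Near g f cg cf s gs<fs
            (q , c<q , q∈)  = to (L-rounded σ c) c∈
            (r , q<r , Pr)  = to (L⇔ q) q∈
            (m , m<d , m∈)  = to (R-rounded σ d) d∈
            d∈a             = ≤-<⇒R a (λ p p∈ → L<R σ (a≤σ p p∈) m∈) m<d
            c∉a : c ∉ L a
            c∉a c∈a         = <ʳ-asym (f â) (g â) fa<ga (near â c∈a d∈a)
            a≤q : a ≤ʳ fromℚ q
            a≤q p p∈        = ℚ.<-trans (ℚ.≰⇒> (λ c≤p → c∉a (L-down a c≤p p∈))) c<q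
            q≤b : fromℚ q ≤ʳ b
            q≤b p p<q       = σ≤b p (L-down σ (ℚ.<⇒≤ p<q) q∈)
            t : Point I
            t               = fromℚ q , domain-convex I a (fromℚ q) b a∈I b∈I a≤q q≤b
        in <ʳ-asym (f t) (g t)
             (Pr t a≤q (λ _ p<q → ℚ.<-trans p<q q<r))
             (near t c<q (L<R σ q∈ d∈))

  never-meeting : ExcludedMiddle 1ℓ → ∀ f g → Continuous I f → Continuous I g →
                  (∀ t → ¬ f t ≈ʳ g t) → (∀ t → f t <ʳ g t) ⊎ (∀ t → g t <ʳ f t)
  never-meeting em f g cf cg f≉g with em {∃[ a ] (f a <ʳ g a)}
  ... | no ∄a = inj₂ g<f
    where
    g<f : ∀ t → g t <ʳ f t
    g<f t with <ʳ-connex em (f t) (g t) (f≉g t)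
    ... | inj₁ ft<gt = ⊥-elim (∄a (t , ft<gt))
    ... | inj₂ gt<ft = gt<ft
  ... | yes (a , fa<ga) = inj₁ f<g
    where
    f<g : ∀ t → f t <ʳ g t
    f<g t with <ʳ-connex em (f t) (g t) (f≉g t)
    ... | inj₁ ft<gt = ft<gt
    ... | inj₂ gt<ft with ≤ʳ-total em (proj₁ a) (proj₁ t)
    ... | inj₁ a≤t = ⊥-elim (no-crossing em f g cf cg f≉g a t a≤t fa<ga gt<ft)
    -- Here the crossing runs from `t` to `a`, with `f` and `g` exchanged.
    ... | inj₂ t<a = ⊥-elim (no-crossing em g f cg cf (λ t → f≉g t ∘ swap) t a
                               (<ʳ⇒≤ʳ (proj₁ t) (proj₁ a) t<a) gt<ft fa<ga)

-- Layers

module _ (em : ExcludedMiddle 1ℓ) {n : ℕ} {G : SimpleGraph n} (F : FunctionRepresentation G) where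
  open FunctionRepresentation F

  Above-trans : ∀ {u v w} → Above F u v → Above F v w → Above F u w
  Above-trans {u} {v} {w} u>v v>w t = <ʳ-trans (fun w t) (fun v t) (fun u t) (v>w t) (u>v t)

  Above-irrefl : ∀ {u} → ¬ Above F u u
  Above-irrefl {u} u>u = let t = domain-point I in <ʳ⇒≱ʳ (fun u t) (fun u t) (u>u t) (≤ʳ-refl (fun u t))

  -- On the finite set `Fin n` this yields well-foundedness, so climbing along `Above` terminates.
  Above-isStrictPartialOrder : IsStrictPartialOrder _≡_ (Above F)
  Above-isStrictPartialOrder = record
    { isEquivalence = isEquivalence
    ; irrefl        = λ { refl → Above-irrefl }
    ; trans         = Above-trans
    ; <-resp-≈      = resp₂ (Above F)
    }

  Adj⇒¬Above : ∀ {u v} → u ≢ v → Adj G u v → ¬ Above F u v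
  Adj⇒¬Above {u} {v} u≢v uv u>v = let (t , ut≤vt , _) = to (adj⇔meet u≢v) uv in
    <ʳ⇒≱ʳ (fun v t) (fun u t) (u>v t) ut≤vt

  ¬Adj⇒comparable : ∀ {u v} → u ≢ v → ¬ Adj G u v → Above F u v ⊎ Above F v u
  ¬Adj⇒comparable {u} {v} u≢v ¬uv = never-meeting I em (fun v) (fun u) (continuous v) (continuous u)
    λ t vt≈ut → ¬uv (from (adj⇔meet u≢v) (t , swap vt≈ut))

  remaining-anti : ∀ {i j u} → i ℕ.≤′ j → u ∈ remaining F j → u ∈ remaining F i
  remaining-anti (ℕ.≤′-reflexive refl) u∈       = u∈
  remaining-anti (ℕ.≤′-step i≤j)       (u∈ , _) = remaining-anti i≤j u∈

  layers-distinct : ∀ {i j u v} → i ℕ.< j → u ∈ layer F i → v ∈ layer F j → u ≢ v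
  -- `i < j` is `suc i ≤ j`, so `v` survives to stage `suc i`, after layer `i` has been removed.
  layers-distinct i<j u∈ (v∈ , _) refl = proj₂ (remaining-anti (ℕ.≤⇒≤′ i<j) v∈) u∈

  -- Keep climbing to a remaining vertex above the current one until a maximal one is reached;
  -- transitivity places it above `u`.
  remaining⇒layer-above : ∀ i {u} → u ∈ remaining F i → u ∉ layer F i →
                          ∃[ w ] (w ∈ layer F i × Above F w u)
  remaining⇒layer-above i {u} = go (spo-wellFounded Above-isStrictPartialOrder u)
    where
    go : ∀ {u} → Acc (Above F) u → u ∈ remaining F i → u ∉ layer F i →
         ∃[ w ] (w ∈ layer F i × Above F w u)
    go {u} (acc rec) u∈ u∉ with em {∃[ w ] (w ∈ remaining F i × Above F w u)}
    ... | no ∄w = ⊥-elim (u∉ (u∈ , ∄w))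
    ... | yes (w , w∈ , w>u) with em {w ∈ layer F i}
    ... | yes w∈layer = w , w∈layer , w>u
    ... | no  w∉layer = let (x , x∈ , x>w) = go (rec {w} w>u) w∈ w∉layer in x , x∈ , Above-trans {x} {w} {u} x>w w>u

  layer-above : ∀ {i j v} → i ℕ.< j → v ∈ layer F j → ∃[ w ] (w ∈ layer F i × Above F w v)
  layer-above {i} i<j (v∈ , _) = let (v∈i , v∉i) = remaining-anti (ℕ.≤⇒≤′ i<j) v∈ in
    remaining⇒layer-above i v∈i v∉i

  adjacent-to-intermediate-layer :
    ∀ {i j l u v} → i ℕ.< j → j ℕ.< l → u ∈ layer F i → v ∈ layer F l → Adj G u v →
    ∃[ w ] (w ∈ layer F j × Adj G u w)
  adjacent-to-intermediate-layer {u = u} i<j j<l u∈ v∈ uv with layer-above j<l v∈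
  ... | w , w∈ , w>v with em {Adj G u w}
  ... | yes uw = w , w∈ , uw
  ... | no ¬uw with ¬Adj⇒comparable (layers-distinct i<j u∈ w∈) ¬uw
  ... | inj₁ u>w = ⊥-elim (Adj⇒¬Above (layers-distinct (ℕ.<-trans i<j j<l) u∈ v∈) uv (Above-trans u>w w>v))
  -- Since `i < j`, `w` is still present when layer `i` is formed and so competes with `u`.
  ... | inj₂ w>u = ⊥-elim (proj₂ u∈ (w , remaining-anti (ℕ.≤⇒≤′ (ℕ.<⇒≤ i<j)) (proj₁ w∈) , w>u))

-- Interval graphs

-- With an explicit denominator of one, comparison unfolds to integers multiplied by one.
fromℕ : ℕ → ℚ
fromℕ i = mkℚ (+ i) 0 (Coprimality.sym (Coprimality.1-coprimeTo i))

fromℕ-mono-≤ : ∀ {i j} → i ℕ.≤ j → fromℕ i ≤ℚ fromℕ j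
fromℕ-mono-≤ i≤j = *≤* (ℤ.*-monoʳ-≤-nonNeg (+ 1) (+≤+ i≤j))

fromℕ-cancel-≤ : ∀ {i j} → fromℕ i ≤ℚ fromℕ j → i ℕ.≤ j
fromℕ-cancel-≤ {i} {j} (*≤* i≤j) = ℤ.drop‿+≤+ (subst₂ ℤ._≤_ (ℤ.*-identityʳ (+ i)) (ℤ.*-identityʳ (+ j)) i≤j)

consecutive⇒interval : ExcludedMiddle 1ℓ → ∀ {k} (H : SimpleGraph k) →
  (∀ {i j l} → toℕ i ℕ.< toℕ j → toℕ j ℕ.< toℕ l → Adj H i l → Adj H i j) →
  IsIntervalGraph H
consecutive⇒interval em {k} H consecutive = J , J-interval , adj⇔
  where
  pos : Fin k → ℝ
  pos i = fromℚ (fromℕ (toℕ i))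

  pos-mono : ∀ {i j} → toℕ i ℕ.≤ toℕ j → pos i ≤ʳ pos j
  pos-mono = fromℚ-mono-≤ ∘ fromℕ-mono-≤

  pos-cancel : ∀ i j → pos i ≤ʳ pos j → toℕ i ℕ.≤ toℕ j
  pos-cancel i j = fromℕ-cancel-≤ ∘ fromℚ-cancel-≤ {fromℕ (toℕ i)} {fromℕ (toℕ j)}

  -- J i = [i, r(i)], without choosing the last neighbour r(i).
  J : Fin k → Pred ℝ 0ℓ
  J i x = pos i ≤ʳ x × ∃[ l ] (Truth em (i ≡ l ⊎ Adj H i l) × x ≤ʳ pos l)

  start∈J : ∀ i → pos i ∈ J i
  -- The disjunct `i ≡ l` keeps `J i` nonempty when `i` has no later neighbour.
  start∈J i = ≤ʳ-refl (pos i) , i , fromWitness (inj₁ refl) , ≤ʳ-refl (pos i)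

  J-interval : ∀ i → IsInterval (J i)
  J-interval i = record
    { nonempty = pos i , start∈J i
    ; convex   = λ {x} {y} {z} (i≤x , _) (_ , l , il , z≤l) x≤y y≤z →
        ≤ʳ-trans {pos i} {x} {y} i≤x x≤y , l , il , ≤ʳ-trans {y} {z} {pos l} y≤z z≤l
    }

  adj⇒meet : ∀ {i j} → toℕ i ℕ.< toℕ j → Adj H i j → J i ≬ J j
  adj⇒meet {i} {j} i<j ij =
    pos j , (pos-mono (ℕ.<⇒≤ i<j) , j , fromWitness (inj₂ ij) , ≤ʳ-refl (pos j)) , start∈J j

  meet⇒adj : ∀ {i j} → toℕ i ℕ.< toℕ j → J i ≬ J j → Adj H i j
  meet⇒adj {i} {j} i<j (x , (_ , l , il , x≤l) , (j≤x , _)) with toWitness il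
  -- The common point `x` lies between `pos j` and `pos l`, whence `j ≤ l`; this excludes `l = i`.
  ... | inj₁ refl = ⊥-elim (ℕ.<⇒≱ i<j (pos-cancel j l (≤ʳ-trans {pos j} {x} {pos l} j≤x x≤l)))
  ... | inj₂ i~l with ℕ.m≤n⇒m<n∨m≡n (pos-cancel j l (≤ʳ-trans {pos j} {x} {pos l} j≤x x≤l))
  ... | inj₁ j<l = consecutive i<j j<l i~l
  ... | inj₂ j≡l = subst (Adj H i) (sym (Fin.toℕ-injective j≡l)) i~l

  adj⇔ : ∀ {i j} → i ≢ j → Adj H i j ⇔ J i ≬ J j
  adj⇔ {i} {j} i≢j with Fin.<-cmp i j
  ... | tri< i<j _ _ = mk⇔ (adj⇒meet i<j) (meet⇒adj i<j)
  ... | tri≈ _ i≡j _ = ⊥-elim (i≢j i≡j)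
  ... | tri> _ _ j<i = mk⇔ (map₂ swap ∘ adj⇒meet j<i ∘ adj-sym H)
                           (adj-sym H ∘ meet⇒adj j<i ∘ map₂ swap)

mainTheorem2 : ExcludedMiddle 1ℓ →
    ∀ {n : ℕ} (G : SimpleGraph n) (F : FunctionRepresentation G) →
    ∀ (k : ℕ) → HasLayers F k →
    IsIntervalGraph (contractionGraph F k)
mainTheorem2 em G F k _ = consecutive⇒interval em (contractionGraph F k)
  -- The edge between layers `i` and `l` keeps its end `u`; only `v` is replaced, by a vertex of
  -- layer `j`.
  λ i<j j<l (_ , u , v , u∈ , v∈ , uv) →
    let (w , w∈ , uw) = adjacent-to-intermediate-layer em F i<j j<l u∈ v∈ uv
    in (λ { refl → ℕ.<-irrefl refl i<j }) , u , w , u∈ , w∈ , uw
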